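{- For every integer $m\geq 2$ and every integer $n\geq 2$, the graph $mL_n$ (the disjoint union of $m$ copies of the ladder $L_n$) is $C_4$-supermagic.
   Context: All graphs are finite and simple. For a graph $H$, a graph $G=(V,E)$ has an $H$-covering if every edge of $G$ belongs to a subgraph of $G$ isomorphic to $H$. For such $G$, an $H$-magic labeling is a bijection $\lambda: V\cup E\to\{1,2,\dots,|V|+|E|\}$ for which there is a constant $c$ such that for every subgraph $H'=(V',E')$ of $G$ isomorphic to $H$, $\sum_{v\in V'}\lambda(v)+\sum_{e\in E'}\lambda(e)=c$. It is $H$-supermagic if moreover $\{\lambda(v):v\in V\}=\{1,\dots,|V|\}$; $G$ is $H$-supermagic if it admits such a labeling. $C_k$ is the cycle of length $k$. $mG$ denotes the disjoint union of $m$ copies of $G$. The ladder $L_n=P_n\times P_2$ ($n\ge2$) has vertices $u_i,v_i$ ($1\le i\le n$) and edges $u_iv_i$ ($1\le i\le n$), $u_iu_{i+1}$ and $v_iv_{i+1}$ ($1\le i\le n-1$). -}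

module Defs where

open import Data.Empty using (⊥-elim)
open import Data.Fin using (Fin; zero; suc; toℕ; inject₁)
open import Data.Fin.Properties
  using (toℕ<n; toℕ-fromℕ<; inject₁-injective; suc-injective; +↔⊎; *↔×)
open import Data.List using (List; _∷_; length; lookup; map)
open import Data.List.Membership.Propositional using (_∈_)
open import Data.List.Membership.Propositional.Properties using (∈-lookup)
open import Data.List.Relation.Unary.All as All using (All)
import Data.List.Relation.Unary.AllPairs as AllPairs
open import Data.List.Relation.Unary.Any using (index)
open import Data.List.Relation.Unary.Any.Properties using (lookup-index)
open import Data.List.Relation.Unary.Unique.Propositional using (Unique)
open import Data.Nat
  using (ℕ; suc; _+_; _*_; _∸_; _≤_; _<_; _≤?_; _<?_; NonZero; z≤n; s≤s)
open import Data.Nat.DivMod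
  using (_mod_; _%_; m<n⇒m%n≡m; [m+n]%n≡m%n; m%n<n; %-distribˡ-+; m%n%n≡m%n)
open import Data.Nat.ListAction using (sum)
open import Data.Nat.Properties
  using (<-trans; <⇒≢; m<n+m; m∸n+n≡m; ≮⇒≥; +-monoˡ-<; +-cancelʳ-<; +-comm)
open import Data.Product using (Σ-syntax; ∃-syntax; _×_; _,_; proj₁; proj₂)
open import Data.Product.Function.NonDependent.Propositional using (_×-↔_)
open import Data.Sum using (_⊎_; inj₁; inj₂)
open import Data.Sum.Function.Propositional using (_⊎-↔_)
open import Function using (_∘_; id; _↔_; _⤖_; _⇔_; mk↔ₛ′; Bijection; Inverse)
open import Function.Construct.Composition using (_↔-∘_)
open import Function.Construct.Identity using (↔-id)
open import Function.Construct.Symmetry using (↔-sym)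
open import Relation.Binary.PropositionalEquality
  using (_≡_; _≢_; refl; sym; trans; cong; cong₂; subst; module ≡-Reasoning)
open import Relation.Nullary using (yes; no)
open import Relation.Nullary.Decidable using (True)

-- Edges form a type of their own because they carry labels.  An edge stands
-- for the unordered pair {src e, tgt e}; the orientation has no meaning.
record Graph : Set₁ where
  field
    Vertex Edge : Set
    order size  : ℕ
    vertices    : Vertex ↔ Fin order
    edges       : Edge ↔ Fin size
    src tgt     : Edge → Vertex

  Joins : Edge → Vertex → Vertex → Set
  Joins e x y = (src e ≡ x × tgt e ≡ y) ⊎ (src e ≡ y × tgt e ≡ x)

  field
    loopless : ∀ e → src e ≢ tgt e
    simple   : ∀ {e f} → Joins f (src e) (tgt e) → e ≡ f

  Adjacent : Vertex → Vertex → Set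
  Adjacent x y = ∃[ e ] Joins e x y

open Graph

record _≅_ (G H : Graph) : Set where
  field
    vertex-bijection : Vertex G ↔ Vertex H

  open Inverse vertex-bijection public using (to; from)

  field
    adjacency : ∀ x y → Adjacent G x y ⇔ Adjacent H (to x) (to y)

-- Finite sets of vertices and edges are given by duplicate-free lists, so that
-- a sum over such a set is a list sum; the order of the list has no meaning.
record Subgraph (G : Graph) : Set where
  field
    vs        : List (Vertex G)
    es        : List (Edge G)
    vs-unique : Unique vs
    es-unique : Unique es
    closed    : All (λ e → src G e ∈ vs × tgt G e ∈ vs) es

open Subgraph

module _ {A : Set} where

  lookup-injective : ∀ {xs : List A} → Unique xs →
                     ∀ i j → lookup xs i ≡ lookup xs j → i ≡ j
  lookup-injective (_ AllPairs.∷ _) zero zero _ = refl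
  lookup-injective {_ ∷ xs} (p AllPairs.∷ _) zero (suc j) eq =
    ⊥-elim (All.lookup p (∈-lookup {xs = xs} j) eq)
  lookup-injective {_ ∷ xs} (p AllPairs.∷ _) (suc i) zero eq =
    ⊥-elim (All.lookup p (∈-lookup {xs = xs} i) (sym eq))
  lookup-injective (_ AllPairs.∷ u) (suc i) (suc j) eq =
    cong suc (lookup-injective u i j eq)

  index-injective : ∀ {xs : List A} {x y} (p : x ∈ xs) (q : y ∈ xs) →
                    index p ≡ index q → x ≡ y
  index-injective {xs} p q eq =
    trans (lookup-index p) (trans (cong (lookup xs) eq) (sym (lookup-index q)))

-- A subgraph as a graph in its own right, on the positions of its two lists.
toGraph : {G : Graph} → Subgraph G → Graph
toGraph {G} S = record
  { Vertex   = Fin (length (vs S))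
  ; Edge     = Fin (length (es S))
  ; order    = length (vs S)
  ; size     = length (es S)
  ; vertices = ↔-id _
  ; edges    = ↔-id _
  ; src      = λ i → index (src∈ i)
  ; tgt      = λ i → index (tgt∈ i)
  ; loopless = λ i eq →
      loopless G (lookup (es S) i) (index-injective (src∈ i) (tgt∈ i) eq)
  ; simple   = λ {i} {j} →
      λ { (inj₁ (p , q)) → lookup-injective (es-unique S) i j
            (simple G (inj₁ ( index-injective (src∈ j) (src∈ i) p
                            , index-injective (tgt∈ j) (tgt∈ i) q)))
        ; (inj₂ (p , q)) → lookup-injective (es-unique S) i j
            (simple G (inj₂ ( index-injective (src∈ j) (tgt∈ i) p
                            , index-injective (tgt∈ j) (src∈ i) q)))
        }
  }
  where
  ends∈ : ∀ i → src G (lookup (es S) i) ∈ vs S × tgt G (lookup (es S) i) ∈ vs S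
  ends∈ i = All.lookup (closed S) (∈-lookup {xs = es S} i)

  src∈ : ∀ i → src G (lookup (es S) i) ∈ vs S
  src∈ i = proj₁ (ends∈ i)

  tgt∈ : ∀ i → tgt G (lookup (es S) i) ∈ vs S
  tgt∈ i = proj₂ (ends∈ i)

_HasCovering_ : Graph → Graph → Set
G HasCovering H = ∀ (e : Edge G) → Σ[ S ∈ Subgraph G ] (toGraph S ≅ H) × (e ∈ es S)

Labeling : Graph → Set
Labeling G = (Vertex G ⊎ Edge G) ⤖ Fin (order G + size G)

module _ {G : Graph} (lab : Labeling G) where

  -- Fin N is {0,…,N-1}; labels are shifted to {1,…,N}.
  label : Vertex G ⊎ Edge G → ℕ
  label x = suc (toℕ (Bijection.to lab x))

  weight : Subgraph G → ℕ
  weight S = sum (map (label ∘ inj₁) (vs S)) + sum (map (label ∘ inj₂) (es S))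

  IsMagic : Graph → Set
  IsMagic H = ∃[ c ] (∀ (S : Subgraph G) → toGraph S ≅ H → weight S ≡ c)

  IsSupermagic : Graph → Set
  IsSupermagic H = IsMagic H ×
    (∀ k → (∃[ v ] label (inj₁ v) ≡ k) ⇔ (1 ≤ k × k ≤ order G))

Supermagic : (H G : Graph) → Set
Supermagic H G = G HasCovering H × Σ[ lab ∈ Labeling G ] IsSupermagic {G} lab H

private
  shift-≢ : ∀ {k} .{{_ : NonZero k}} d i → 0 < d → d < k → i < k → (d + i) % k ≢ i
  shift-≢ {k} d i 0<d d<k i<k eq with d + i <? k
  ... | yes d+i<k = <⇒≢ (m<n+m i 0<d) (sym (trans (sym (m<n⇒m%n≡m d+i<k)) eq))
  ... | no  d+i≮k = <⇒≢ r<i (trans (sym r≡) eq)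
    where
    r = d + i ∸ k
    r+k≡ : r + k ≡ d + i
    r+k≡ = m∸n+n≡m (≮⇒≥ d+i≮k)
    r<i : r < i
    r<i = +-cancelʳ-< k r i (subst (_< i + k) (sym r+k≡)
            (subst (d + i <_) (+-comm k i) (+-monoˡ-< i d<k)))
    r≡ : (d + i) % k ≡ r
    r≡ = trans (cong (_% k) (sym r+k≡))
           (trans ([m+n]%n≡m%n r k) (m<n⇒m%n≡m (<-trans r<i i<k)))

-- Vertices and edges are both indexed by ℤ/k, edge i joining i and i + 1.
cycle : (k : ℕ) {3≤k : True (3 ≤? k)} → Graph
cycle k@(suc (suc (suc _))) = record
  { Vertex   = Fin k
  ; Edge     = Fin k
  ; order    = k
  ; size     = k
  ; vertices = ↔-id _
  ; edges    = ↔-id _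
  ; src      = id
  ; tgt      = next
  ; loopless = λ i eq → shift-≢ 1 (toℕ i) (s≤s z≤n) (s≤s (s≤s z≤n)) (toℕ<n i)
      (trans (sym (toℕ-next i)) (cong toℕ (sym eq)))
  ; simple   = λ
      { (inj₁ (refl , _))     → refl
      ; {e} (inj₂ (refl , q)) → ⊥-elim (next²≢ e q)
      }
  }
  where
  next : Fin k → Fin k
  next i = suc (toℕ i) mod k

  toℕ-next : ∀ i → toℕ (next i) ≡ suc (toℕ i) % k
  toℕ-next i = toℕ-fromℕ< (m%n<n (suc (toℕ i)) k)

  next²≢ : ∀ i → next (next i) ≢ i
  next²≢ i eq = shift-≢ 2 (toℕ i) (s≤s z≤n) (s≤s (s≤s (s≤s z≤n))) (toℕ<n i) (begin
    (1 + (1 + toℕ i)) % k                   ≡⟨ %-distribˡ-+ 1 (1 + toℕ i) k ⟩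
    (1 % k + (1 + toℕ i) % k) % k           ≡⟨ cong (λ z → (1 % k + z) % k) (m%n%n≡m%n (1 + toℕ i) k) ⟨
    (1 % k + (1 + toℕ i) % k % k) % k       ≡⟨ %-distribˡ-+ 1 ((1 + toℕ i) % k) k ⟨
    (1 + (1 + toℕ i) % k) % k               ≡⟨ cong (λ z → suc z % k) (toℕ-next i) ⟨
    suc (toℕ (next i)) % k                  ≡⟨ toℕ-next (next i) ⟨
    toℕ (next (next i))                     ≡⟨ cong toℕ eq ⟩
    toℕ i                                   ∎)
    where open ≡-Reasoning

-- Disjoint union of m copies.
copies : ℕ → Graph → Graph
copies m G = record
  { Vertex   = Fin m × Vertex G
  ; Edge     = Fin m × Edge G
  ; order    = m * order G
  ; size     = m * size G
  ; vertices = ↔-sym *↔× ↔-∘ (↔-id _ ×-↔ vertices G)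
  ; edges    = ↔-sym *↔× ↔-∘ (↔-id _ ×-↔ edges G)
  ; src      = λ (j , e) → j , src G e
  ; tgt      = λ (j , e) → j , tgt G e
  ; loopless = λ (_ , e) eq → loopless G e (cong proj₂ eq)
  ; simple   = λ
      { (inj₁ (p , q)) → cong₂ _,_ (sym (cong proj₁ p))
                           (simple G (inj₁ (cong proj₂ p , cong proj₂ q)))
      ; (inj₂ (p , q)) → cong₂ _,_ (sym (cong proj₁ p))
                           (simple G (inj₂ (cong proj₂ p , cong proj₂ q)))
      }
  }

data LadderVertex (n : ℕ) : Set where
  u v : Fin n → LadderVertex n

-- rung i is uᵢvᵢ; u-rail i is uᵢuᵢ₊₁; v-rail i is vᵢvᵢ₊₁.
data LadderEdge (n : ℕ) : Set where
  rung          : Fin n → LadderEdge n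
  u-rail v-rail : Fin (n ∸ 1) → LadderEdge n

left right : ∀ {n} → Fin (n ∸ 1) → Fin n
left  {suc _} = inject₁
right {suc _} = suc

private
  left-injective : ∀ {n} {i j : Fin (n ∸ 1)} → left {n} i ≡ left j → i ≡ j
  left-injective {suc _} = inject₁-injective

  left≢right : ∀ {n} (i : Fin (n ∸ 1)) → left {n} i ≢ right i
  left≢right {suc _} zero    ()
  left≢right {suc (suc _)} (suc i) eq = left≢right i (suc-injective eq)

  no-swap : ∀ {n} (i j : Fin (n ∸ 1)) → left {n} i ≡ right j → right {n} i ≢ left j
  no-swap {suc _} zero    _ ()
  no-swap {suc (suc _)} (suc i) zero    _ ()
  no-swap {suc (suc _)} (suc i) (suc j) p q =
    no-swap i j (suc-injective p) (suc-injective q)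

  u-injective : ∀ {n} {i j : Fin n} → u i ≡ u j → i ≡ j
  u-injective refl = refl

  v-injective : ∀ {n} {i j : Fin n} → v i ≡ v j → i ≡ j
  v-injective refl = refl

  LadderVertex↔ : ∀ {n} → LadderVertex n ↔ (Fin n ⊎ Fin n)
  LadderVertex↔ = mk↔ₛ′
    (λ { (u i) → inj₁ i ; (v i) → inj₂ i })
    (λ { (inj₁ i) → u i ; (inj₂ i) → v i })
    (λ { (inj₁ _) → refl ; (inj₂ _) → refl })
    (λ { (u _) → refl ; (v _) → refl })

  LadderEdge↔ : ∀ {n} → LadderEdge n ↔ (Fin n ⊎ Fin (n ∸ 1) ⊎ Fin (n ∸ 1))
  LadderEdge↔ = mk↔ₛ′
    (λ { (rung i) → inj₁ i ; (u-rail i) → inj₂ (inj₁ i) ; (v-rail i) → inj₂ (inj₂ i) })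
    (λ { (inj₁ i) → rung i ; (inj₂ (inj₁ i)) → u-rail i ; (inj₂ (inj₂ i)) → v-rail i })
    (λ { (inj₁ _) → refl ; (inj₂ (inj₁ _)) → refl ; (inj₂ (inj₂ _)) → refl })
    (λ { (rung _) → refl ; (u-rail _) → refl ; (v-rail _) → refl })

ladder : ℕ → Graph
ladder n = record
  { Vertex   = LadderVertex n
  ; Edge     = LadderEdge n
  ; order    = n + n
  ; size     = n + ((n ∸ 1) + (n ∸ 1))
  ; vertices = ↔-sym +↔⊎ ↔-∘ LadderVertex↔
  ; edges    = ↔-sym +↔⊎ ↔-∘ ((↔-id _ ⊎-↔ ↔-sym +↔⊎) ↔-∘ LadderEdge↔)
  ; src      = start
  ; tgt      = end
  ; loopless = λ
      { (u-rail i) eq → left≢right i (u-injective eq)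
      ; (v-rail i) eq → left≢right i (v-injective eq)
      }
  ; simple   = λ {e} {f} → unique e f
  }
  where
  start end : LadderEdge n → LadderVertex n
  start (rung i)   = u i
  start (u-rail i) = u (left i)
  start (v-rail i) = v (left i)
  end (rung i)   = v i
  end (u-rail i) = u (right i)
  end (v-rail i) = v (right i)

  unique : ∀ e f → (start f ≡ start e × end f ≡ end e) ⊎
                   (start f ≡ end e × end f ≡ start e) → e ≡ f
  unique (rung _)   (rung _)   (inj₁ (refl , _)) = refl
  unique (rung _)   (rung _)   (inj₂ (() , _))
  unique (rung _)   (u-rail _) (inj₁ (_ , ()))
  unique (rung _)   (u-rail _) (inj₂ (() , _))
  unique (rung _)   (v-rail _) (inj₁ (() , _))
  unique (rung _)   (v-rail _) (inj₂ (_ , ()))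
  unique (u-rail _) (rung _)   (inj₁ (_ , ()))
  unique (u-rail _) (rung _)   (inj₂ (_ , ()))
  unique (u-rail _) (u-rail _) (inj₁ (p , _)) =
    cong u-rail (left-injective (u-injective (sym p)))
  unique (u-rail i) (u-rail j) (inj₂ (p , q)) =
    ⊥-elim (no-swap j i (u-injective p) (u-injective q))
  unique (u-rail _) (v-rail _) (inj₁ (() , _))
  unique (u-rail _) (v-rail _) (inj₂ (() , _))
  unique (v-rail _) (rung _)   (inj₁ (() , _))
  unique (v-rail _) (rung _)   (inj₂ (() , _))
  unique (v-rail _) (u-rail _) (inj₁ (() , _))
  unique (v-rail _) (u-rail _) (inj₂ (() , _))
  unique (v-rail _) (v-rail _) (inj₁ (p , _)) =
    cong v-rail (left-injective (v-injective (sym p)))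
  unique (v-rail i) (v-rail j) (inj₂ (p , q)) =
    ⊥-elim (no-swap j i (v-injective p) (v-injective q))

{-# OPTIONS --safe #-}

-- Write n = K + 2, h = ⌈n/2⌉, and let π list the even positions before the odd
-- ones: π(2k) = k, π(2k+1) = h + k.  The single ladder Lₙ is labelled by
--   u_a ↦ n-1-a,  v_a ↦ n + π(a),  rung a ↦ π(a)  (edges offset by 2n),
-- and by complementary pairs on the two rails.  The column sum of u_a, v_a and
-- rung a depends on a only through n-1-a + 2π(a), that is, on the parity of a,
-- so two consecutive columns have a constant sum, and so do the two rail edges
-- between them.
--
-- To pass to m copies, blow every label x up to the block m x + {0,…,m-1} and
-- run through the block by j or by m-1-j in copy j.  The order is reversed on
-- the v side and on the rungs at odd positions, so that each square has four
-- elements of either kind and the dependence on j cancels.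

module Submission where

open import Defs
open import Data.Empty using (⊥-elim)
open import Data.Fin
  using (Fin; zero; suc; toℕ; fromℕ<; opposite; inject₁; _↑ˡ_; _↑ʳ_)
open import Data.Fin.Patterns using (0F; 1F; 2F; 3F)
open import Data.Fin.Permutation using (Permutation′; cast-id; reverse)
open import Data.Fin.Properties
  using (toℕ-↑ˡ; toℕ-↑ʳ; toℕ-cast; toℕ-combine; toℕ<n; toℕ-fromℕ<; toℕ-injective;
         toℕ-inject₁; opposite-prop; +↔⊎; *↔×)
open import Data.List using (List; []; _∷_; length; lookup; map; tabulate)
open import Data.List.Membership.Propositional using (_∈_)
open import Data.List.Membership.Propositional.Properties
  using (∈-lookup; ∈-tabulate⁺; ∈-tabulate⁻)
open import Data.List.Membership.Propositional.Properties.WithK using (unique∧set⇒bag)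
open import Data.List.Properties using (map-cong)
open import Data.List.Relation.Binary.BagAndSetEquality using (∼bag⇒↭)
open import Data.List.Relation.Binary.Permutation.Propositional using (_↭_)
open import Data.List.Relation.Binary.Permutation.Propositional.Properties using (map⁺)
open import Data.List.Relation.Unary.All as All using ([]; _∷_)
open import Data.List.Relation.Unary.AllPairs using ([]; _∷_)
open import Data.List.Relation.Unary.Any using (here; there; index)
open import Data.List.Relation.Unary.Any.Properties using (lookup-index)
open import Data.List.Relation.Unary.Unique.Propositional using (Unique)
open import Data.List.Relation.Unary.Unique.Propositional.Properties using (tabulate⁺)
open import Data.Nat
  using (ℕ; zero; suc; _+_; _*_; _∸_; _≤_; _<_; z≤n; s≤s; ⌊_/2⌋; ⌈_/2⌉)
open import Data.Nat.ListAction using (sum)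
open import Data.Nat.ListAction.Properties using (sum-↭)
open import Data.Nat.Properties
  using (+-comm; +-suc; *-comm; +-∸-assoc; m≤m+n; m+n∸m≡n; m+[n∸m]≡n; m≤n⇒∃[o]m+o≡n;
         ⌊n/2⌋+⌈n/2⌉≡n)
open import Data.Nat.Tactic.RingSolver using (solve-∀)
open import Data.Product using (∃-syntax; _×_; _,_; proj₁; proj₂; map₂; swap)
open import Data.Sum as Sum using (_⊎_; inj₁; inj₂; [_,_]′)
open import Data.Sum.Function.Propositional using (_⊎-↔_)
open import Function using (_∘_; id; _↔_; _⇔_; mk↔ₛ′; mk⇔; Inverse; Equivalence)
open import Function.Construct.Composition using (_↔-∘_)
open import Function.Construct.Identity using (↔-id)
open import Function.Construct.Symmetry using (↔-sym)
open import Function.Properties.Inverse using (↔⇒⤖)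
open import Relation.Binary.PropositionalEquality
  using (_≡_; _≢_; _≗_; refl; sym; trans; cong; cong₂; subst; subst₂)

open Graph
open Subgraph
open Inverse using (to; from; strictlyInverseˡ; strictlyInverseʳ)

-- Subgraphs isomorphic to a given graph

from-injective : ∀ {A B : Set} (A↔B : A ↔ B) {x y} → from A↔B x ≡ from A↔B y → x ≡ y
from-injective A↔B {x} {y} eq = trans (sym (strictlyInverseˡ A↔B x))
  (trans (cong (to A↔B) eq) (strictlyInverseˡ A↔B y))

module _ (G : Graph) where

  joins-unique : ∀ {e f x y} → Joins G e x y → Joins G f x y → e ≡ f
  joins-unique (inj₁ (refl , refl)) q = simple G q
  joins-unique (inj₂ (refl , refl)) q = simple G (Sum.swap q)

  joins-ends : ∀ {e x y x′ y′} → Joins G e x y → Joins G e x′ y′ →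
               (x ≡ x′ × y ≡ y′) ⊎ (x ≡ y′ × y ≡ x′)
  joins-ends (inj₁ (refl , refl)) (inj₁ (p , q)) = inj₁ (p , q)
  joins-ends (inj₁ (refl , refl)) (inj₂ (p , q)) = inj₂ (p , q)
  joins-ends (inj₂ (refl , refl)) (inj₁ (p , q)) = inj₂ (q , p)
  joins-ends (inj₂ (refl , refl)) (inj₂ (p , q)) = inj₁ (q , p)

-- `_≅_` provides a bijection on vertices only; the one on edges is recovered here from the
-- simplicity of both graphs.
module Pullback {G H : Graph} (iso : G ≅ H) where
  open _≅_ iso using (vertex-bijection; adjacency) renaming (to to φ; from to φ⁻¹)

  adjacent : ∀ e → Adjacent G (φ⁻¹ (src H e)) (φ⁻¹ (tgt H e))
  adjacent e = Equivalence.from (adjacency _ _)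
    (e , inj₁ ( sym (strictlyInverseˡ vertex-bijection (src H e))
              , sym (strictlyInverseˡ vertex-bijection (tgt H e))))

  edge : Edge H → Edge G
  edge e = proj₁ (adjacent e)

  edge-joins : ∀ {e x y} → Joins H e x y → Joins G (edge e) (φ⁻¹ x) (φ⁻¹ y)
  edge-joins {e} (inj₁ (refl , refl)) = proj₂ (adjacent e)
  edge-joins {e} (inj₂ (refl , refl)) = Sum.swap (proj₂ (adjacent e))

  -- A common edge has one pair of ends, so e and f have the same ends up to order, and H is simple.
  edge-injective : ∀ {e f} → edge e ≡ edge f → e ≡ f
  edge-injective {e} {f} eq = simple H (Sum.map cancel cancel (joins-ends G
    (subst (λ d → Joins G d (φ⁻¹ (src H f)) (φ⁻¹ (tgt H f))) (sym eq)
      (edge-joins (inj₁ (refl , refl))))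
    (edge-joins (inj₁ (refl , refl)))))
    where
    cancel : ∀ {x y x′ y′} → φ⁻¹ x ≡ φ⁻¹ x′ × φ⁻¹ y ≡ φ⁻¹ y′ → x ≡ x′ × y ≡ y′
    cancel (p , q) = from-injective vertex-bijection p , from-injective vertex-bijection q

  edge-surjective : ∀ e → ∃[ f ] e ≡ edge f
  edge-surjective e
    with f , f-joins ← Equivalence.to (adjacency (src G e) (tgt G e)) (e , inj₁ (refl , refl))
    = f , joins-unique G (inj₁ (refl , refl))
        (subst₂ (Joins G (edge f)) (strictlyInverseʳ vertex-bijection (src G e))
          (strictlyInverseʳ vertex-bijection (tgt G e)) (edge-joins f-joins))

-- Duplicate-free lists with the same members agree as bags, hence up to order. Sums over the lists
-- of a subgraph can thus be taken in the order of H.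
unique⇒↭-tabulate : ∀ {A : Set} {xs : List A} {k} {f : Fin k → A} → Unique xs →
                    (∀ {i j} → f i ≡ f j → i ≡ j) → (∀ i → f i ∈ xs) →
                    (∀ {x} → x ∈ xs → ∃[ i ] x ≡ f i) → xs ↭ tabulate f
unique⇒↭-tabulate {xs = xs} {f = f} xs! f-injective f∈xs covers =
  ∼bag⇒↭ (unique∧set⇒bag xs! (tabulate⁺ f-injective) (mk⇔ forth back))
  where
  forth : ∀ {x} → x ∈ xs → x ∈ tabulate f
  forth x∈ with i , refl ← covers x∈ = ∈-tabulate⁺ i

  back : ∀ {x} → x ∈ tabulate f → x ∈ xs
  back x∈ with i , refl ← ∈-tabulate⁻ x∈ = f∈xs i

lookup-covers : ∀ {A B : Set} {xs : List A} {f : B → Fin (length xs)} →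
                (∀ i → ∃[ k ] i ≡ f k) → ∀ {x} → x ∈ xs → ∃[ k ] x ≡ lookup xs (f k)
lookup-covers {xs = xs} covers x∈ with k , eq ← covers (index x∈) =
  k , trans (lookup-index x∈) (cong (lookup xs) eq)

module Enumeration {G H : Graph} (S : Subgraph G) (iso : toGraph S ≅ H) where
  open _≅_ iso using (vertex-bijection) renaming (to to φ; from to φ⁻¹)
  open Pullback iso

  vertexOf : Vertex H → Vertex G
  vertexOf = lookup (vs S) ∘ φ⁻¹

  edgeOf : Edge H → Edge G
  edgeOf = lookup (es S) ∘ edge

  vertexOf-injective : ∀ {x y} → vertexOf x ≡ vertexOf y → x ≡ y
  vertexOf-injective =
    from-injective vertex-bijection ∘ lookup-injective (vs-unique S) _ _

  edgeOf-injective : ∀ {e f} → edgeOf e ≡ edgeOf f → e ≡ f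
  edgeOf-injective = edge-injective ∘ lookup-injective (es-unique S) _ _

  lookup-joins : ∀ {i x y} → Joins (toGraph S) i x y →
                 Joins G (lookup (es S) i) (lookup (vs S) x) (lookup (vs S) y)
  lookup-joins {i} = λ
    { (inj₁ (refl , refl)) → inj₁ (lookup-index src∈ , lookup-index tgt∈)
    ; (inj₂ (refl , refl)) → inj₂ (lookup-index src∈ , lookup-index tgt∈)
    }
    where
    ends∈ = All.lookup (closed S) (∈-lookup {xs = es S} i)
    src∈ = proj₁ ends∈
    tgt∈ = proj₂ ends∈

  edgeOf-joins : ∀ {e x y} → Joins H e x y → Joins G (edgeOf e) (vertexOf x) (vertexOf y)
  edgeOf-joins = lookup-joins ∘ edge-joins

  vertices-↭ : vs S ↭ tabulate (vertexOf ∘ from (vertices H))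
  vertices-↭ = unique⇒↭-tabulate (vs-unique S)
    (from-injective (vertices H) ∘ vertexOf-injective)
    (λ _ → ∈-lookup _)
    (lookup-covers λ i → to (vertices H) (φ i) ,
      sym (trans (cong φ⁻¹ (strictlyInverseʳ (vertices H) (φ i)))
                 (strictlyInverseʳ vertex-bijection i)))

  edges-↭ : es S ↭ tabulate (edgeOf ∘ from (edges H))
  edges-↭ = unique⇒↭-tabulate (es-unique S)
    (from-injective (edges H) ∘ edgeOf-injective)
    (λ _ → ∈-lookup _)
    (lookup-covers λ i → let f , i≡ = edge-surjective i in
      to (edges H) f , trans i≡ (cong edge (sym (strictlyInverseʳ (edges H) f))))

  -- For `cycle 4` the right-hand side computes to the nested sums, ending in `+ 0`, of
  -- `four-cycle`.
  weight-≡ : (lab : Labeling G) (f : Vertex G → ℕ) (g : Edge G → ℕ) →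
    label {G} lab ∘ inj₁ ≗ f → label {G} lab ∘ inj₂ ≗ g →
    weight {G} lab S ≡ sum (map f (tabulate (vertexOf ∘ from (vertices H)))) +
                       sum (map g (tabulate (edgeOf ∘ from (edges H))))
  weight-≡ lab f g label≗f label≗g = cong₂ _+_
    (trans (cong sum (map-cong label≗f (vs S))) (sum-↭ (map⁺ f vertices-↭)))
    (trans (cong sum (map-cong label≗g (es S))) (sum-↭ (map⁺ g edges-↭)))

-- Four-cycles in the ladder

data Rail : Set where
  top bottom : Rail

-- A relation rather than an involution on `Rail`: a function call in the indices of `Step` would
-- block unification.
data Opposite : Rail → Rail → Set where
  top-bottom : Opposite top bottom
  bottom-top : Opposite bottom top

-- Positions are plain numbers here, so that the indices of Step are
-- constructor forms and pattern matching can compare the ends of two walks.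
Point : ℕ → Set
Point m = Fin m × Rail × ℕ

data Link : Set where
  rungᴸ : ℕ → Link
  railᴸ : Rail → ℕ → Link

data Step {m : ℕ} (n : ℕ) : Point m → Fin m × Link → Point m → Set where
  across   : ∀ {j r s a} → Opposite r s → Step n (j , r , a) (j , rungᴸ a) (j , s , a)
  forward  : ∀ {j r a} → suc a < n → Step n (j , r , a) (j , railᴸ r a) (j , r , suc a)
  backward : ∀ {j r a} → suc a < n → Step n (j , r , suc a) (j , railᴸ r a) (j , r , a)

-- Two steps that do not return to their starting point; the letters of a
-- constructor are the initials of its steps.
data Step² {m : ℕ} (n : ℕ) :
           Point m → Fin m × Link → Point m → Fin m × Link → Point m → Set where
  ff : ∀ {j r a} →
       Step² n (j , r , a) (j , railᴸ r a) (j , r , suc a)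
               (j , railᴸ r (suc a)) (j , r , suc (suc a))
  bb : ∀ {j r a} →
       Step² n (j , r , suc (suc a)) (j , railᴸ r (suc a)) (j , r , suc a)
               (j , railᴸ r a) (j , r , a)
  fa : ∀ {j r s a} → suc a < n → Opposite r s →
       Step² n (j , r , a) (j , railᴸ r a) (j , r , suc a)
               (j , rungᴸ (suc a)) (j , s , suc a)
  af : ∀ {j r s a} → suc a < n → Opposite r s →
       Step² n (j , r , a) (j , rungᴸ a) (j , s , a)
               (j , railᴸ s a) (j , s , suc a)
  ba : ∀ {j r s a} → suc a < n → Opposite r s →
       Step² n (j , r , suc a) (j , railᴸ r a) (j , r , a)
               (j , rungᴸ a) (j , s , a)
  ab : ∀ {j r s a} → suc a < n → Opposite r s →
       Step² n (j , r , suc a) (j , rungᴸ (suc a)) (j , s , suc a)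
               (j , railᴸ s a) (j , s , a)

step² : ∀ {m n} {x y z : Point m} {e f} →
        Step n x e y → Step n y f z → x ≢ z → Step² n x e y f z
step² (across top-bottom) (across bottom-top) x≢z = ⊥-elim (x≢z refl)
step² (across bottom-top) (across top-bottom) x≢z = ⊥-elim (x≢z refl)
step² (across o)          (forward l)         _   = af l o
step² (across o)          (backward l)        _   = ab l o
step² (forward l)         (across o)          _   = fa l o
step² (forward _)         (forward _)         _   = ff
step² (forward _)         (backward _)        x≢z = ⊥-elim (x≢z refl)
step² (backward l)        (across o)          _   = ba l o
step² (backward _)        (forward _)         x≢z = ⊥-elim (x≢z refl)
step² (backward _)        (backward _)        _   = bb

module _ {m n : ℕ} (f : Point m → ℕ) (g : Fin m × Link → ℕ) where

  column : Fin m → ℕ → ℕ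
  column j a = f (j , top , a) + f (j , bottom , a) + g (j , rungᴸ a)

  rails : Fin m → ℕ → ℕ
  rails j a = g (j , railᴸ top a) + g (j , railᴸ bottom a)

  Magic : ℕ → Set
  Magic c = ∀ j {a} → suc a < n → column j a + column j (suc a) + rails j a ≡ c

  -- t is the order in which a walk collects the eight labels of a square.
  square-sum : ∀ {c j r s a} {t : (a b c d e f g h : ℕ) → ℕ} →
    Magic c → suc a < n → Opposite r s →
    (∀ a b c d e f g h → t a b c d e f g h ≡ a + b + c + (d + e + f) + (g + h)) →
    t (f (j , r , a)) (f (j , s , a)) (g (j , rungᴸ a))
      (f (j , r , suc a)) (f (j , s , suc a)) (g (j , rungᴸ (suc a)))
      (g (j , railᴸ r a)) (g (j , railᴸ s a)) ≡ c
  square-sum {j = j} magic l top-bottom eq =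
    trans (eq _ _ _ _ _ _ _ _) (magic j l)
  -- `Magic` counts the top rail first, so the roles of the two rails are exchanged.
  square-sum {j = j} {a = a} magic l bottom-top eq =
    trans (eq _ _ _ _ _ _ _ _) (trans
      (exchange (f (j , bottom , a)) (f (j , top , a)) (g (j , rungᴸ a))
        (f (j , bottom , suc a)) (f (j , top , suc a)) (g (j , rungᴸ (suc a)))
        (g (j , railᴸ bottom a)) (g (j , railᴸ top a)))
      (magic j l))
    where
    exchange : ∀ a b c d e f g h →
      a + b + c + (d + e + f) + (g + h) ≡ b + a + c + (e + d + f) + (h + g)
    exchange = solve-∀

  -- The points w₁ and w₃ are distinct common neighbours of w₀ and w₂, which
  -- forces w₀ and w₂ to be diagonally opposite in a square.
  four-cycle : ∀ {c w₀ w₁ w₂ w₃ e₀ e₁ e₂ e₃} → Magic c →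
    Step n w₀ e₀ w₁ → Step n w₁ e₁ w₂ → Step n w₀ e₃ w₃ → Step n w₃ e₂ w₂ →
    w₀ ≢ w₂ → w₁ ≢ w₃ →
    f w₀ + (f w₁ + (f w₂ + (f w₃ + 0))) + (g e₀ + (g e₁ + (g e₂ + (g e₃ + 0)))) ≡ c
  four-cycle {c} magic s₀ s₁ s₃ s₂ w₀≢w₂ = go (step² s₀ s₁ w₀≢w₂) (step² s₃ s₂ w₀≢w₂)
    where
    go : ∀ {w₀ w₁ w₂ w₃ e₀ e₁ e₂ e₃} →
      Step² n w₀ e₀ w₁ e₁ w₂ → Step² n w₀ e₃ w₃ e₂ w₂ → w₁ ≢ w₃ →
      f w₀ + (f w₁ + (f w₂ + (f w₃ + 0))) + (g e₀ + (g e₁ + (g e₂ + (g e₃ + 0)))) ≡ c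
    -- The shared ends refute by unification all pairs except equal shapes, whose midpoints
    -- coincide, and the two ways around a square.
    go ff       ff       w₁≢w₃ = ⊥-elim (w₁≢w₃ refl)
    go bb       bb       w₁≢w₃ = ⊥-elim (w₁≢w₃ refl)
    go (fa _ _) (fa _ _) w₁≢w₃ = ⊥-elim (w₁≢w₃ refl)
    go (af _ _) (af _ _) w₁≢w₃ = ⊥-elim (w₁≢w₃ refl)
    go (ba _ _) (ba _ _) w₁≢w₃ = ⊥-elim (w₁≢w₃ refl)
    go (ab _ _) (ab _ _) w₁≢w₃ = ⊥-elim (w₁≢w₃ refl)
    go (fa l o) (af _ _) _ = square-sum magic l o reorder
      where
      reorder : ∀ a b c d e f g h →
        a + (d + (e + (b + 0))) + (g + (f + (h + (c + 0)))) ≡ a + b + c + (d + e + f) + (g + h)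
      reorder = solve-∀
    go (af l o) (fa _ _) _ = square-sum magic l o reorder
      where
      reorder : ∀ a b c d e f g h →
        a + (b + (e + (d + 0))) + (c + (h + (f + (g + 0)))) ≡ a + b + c + (d + e + f) + (g + h)
      reorder = solve-∀
    go (ba l o) (ab _ _) _ = square-sum magic l o reorder
      where
      reorder : ∀ a b c d e f g h →
        d + (a + (b + (e + 0))) + (g + (c + (h + (f + 0)))) ≡ a + b + c + (d + e + f) + (g + h)
      reorder = solve-∀
    go (ab l o) (ba _ _) _ = square-sum magic l o reorder
      where
      reorder : ∀ a b c d e f g h →
        d + (e + (b + (a + 0))) + (f + (h + (c + (g + 0)))) ≡ a + b + c + (d + e + f) + (g + h)
      reorder = solve-∀

-- Edges of the copies as steps of a walk

module _ {m n : ℕ} where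

  point : Fin m × LadderVertex n → Point m
  point (j , u i) = j , top , toℕ i
  point (j , v i) = j , bottom , toℕ i

  link : Fin m × LadderEdge n → Fin m × Link
  link (j , rung i)   = j , rungᴸ (toℕ i)
  link (j , u-rail i) = j , railᴸ top (toℕ i)
  link (j , v-rail i) = j , railᴸ bottom (toℕ i)

  point-injective : ∀ {x y} → point x ≡ point y → x ≡ y
  point-injective {_ , u _} {_ , u _} eq =
    cong₂ (λ j i → j , u i) (cong proj₁ eq) (toℕ-injective (cong (proj₂ ∘ proj₂) eq))
  point-injective {_ , v _} {_ , v _} eq =
    cong₂ (λ j i → j , v i) (cong proj₁ eq) (toℕ-injective (cong (proj₂ ∘ proj₂) eq))

module _ {m k : ℕ} where

  -- With `suc k` columns, `left` and `right` compute, and a rail index below k yields the bound of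
  -- `forward` and `backward`.
  joins⇒step : ∀ e {x y} → Joins (copies m (ladder (suc k))) e x y →
               Step (suc k) (point x) (link e) (point y)
  joins⇒step (_ , rung _)   (inj₁ (refl , refl)) = across top-bottom
  joins⇒step (_ , rung _)   (inj₂ (refl , refl)) = across bottom-top
  joins⇒step (_ , u-rail i) (inj₁ (refl , refl))
    rewrite toℕ-inject₁ i = forward (s≤s (toℕ<n i))
  joins⇒step (_ , u-rail i) (inj₂ (refl , refl))
    rewrite toℕ-inject₁ i = backward (s≤s (toℕ<n i))
  joins⇒step (_ , v-rail i) (inj₁ (refl , refl))
    rewrite toℕ-inject₁ i = forward (s≤s (toℕ<n i))
  joins⇒step (_ , v-rail i) (inj₂ (refl , refl))
    rewrite toℕ-inject₁ i = backward (s≤s (toℕ<n i))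

-- The permutation π

-- The quotient by 2 tagged with the parity, `inj₁` for even; only the passage from odd to even
-- raises the quotient.
half : ℕ → ℕ ⊎ ℕ
half zero    = inj₁ zero
half (suc a) = [ inj₂ , inj₁ ∘ suc ]′ (half a)

unhalf : ℕ ⊎ ℕ → ℕ
unhalf = [ (λ k → k + k) , (λ k → suc (k + k)) ]′

unhalf-half : ∀ a → a ≡ unhalf (half a)
unhalf-half zero = refl
unhalf-half (suc a) with half a | unhalf-half a
... | inj₁ k | eq = cong suc eq
... | inj₂ k | eq = cong suc (trans eq (sym (+-suc k k)))

-- The bounded form of `half`. It fits its type because ⌈(n+1)/2⌉ computes to 1 + ⌊n/2⌋ and
-- ⌊(n+1)/2⌋ to ⌈n/2⌉.
split : ∀ {n} → Fin n → Fin ⌈ n /2⌉ ⊎ Fin ⌊ n /2⌋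
split zero    = inj₁ zero
split (suc i) = [ inj₂ , inj₁ ∘ suc ]′ (split i)

unsplit : ∀ {n} → Fin ⌈ n /2⌉ ⊎ Fin ⌊ n /2⌋ → Fin n
unsplit {suc n} (inj₁ zero)    = zero
unsplit {suc n} (inj₁ (suc k)) = suc (unsplit (inj₂ k))
unsplit {suc n} (inj₂ k)       = suc (unsplit (inj₁ k))

split-unsplit : ∀ {n} p → split {n} (unsplit p) ≡ p
split-unsplit {suc n} (inj₁ zero)    = refl
split-unsplit {suc n} (inj₁ (suc k)) =
  cong [ inj₂ , inj₁ ∘ suc ]′ (split-unsplit {n} (inj₂ k))
split-unsplit {suc n} (inj₂ k)       =
  cong [ inj₂ , inj₁ ∘ suc ]′ (split-unsplit {n} (inj₁ k))

unsplit-split : ∀ {n} (i : Fin n) → unsplit (split i) ≡ i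
unsplit-split zero = refl
unsplit-split (suc i) with split i | unsplit-split i
... | inj₁ _ | eq = cong suc eq
... | inj₂ _ | eq = cong suc eq

toℕ-split : ∀ {n} (i : Fin n) → Sum.map toℕ toℕ (split i) ≡ half (toℕ i)
toℕ-split zero = refl
toℕ-split (suc i) with split i | toℕ-split i
... | inj₁ _ | eq = cong [ inj₂ , inj₁ ∘ suc ]′ eq
... | inj₂ _ | eq = cong [ inj₂ , inj₁ ∘ suc ]′ eq

unshuffle : ∀ n → Permutation′ n
unshuffle n = cast-id (trans (+-comm ⌈ n /2⌉ ⌊ n /2⌋) (⌊n/2⌋+⌈n/2⌉≡n n)) ↔-∘
  (↔-sym +↔⊎ ↔-∘ mk↔ₛ′ split unsplit split-unsplit unsplit-split)

toℕ-unshuffle : ∀ {n} (i : Fin n) →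
                toℕ (to (unshuffle n) i) ≡ [ id , ⌈ n /2⌉ +_ ]′ (half (toℕ i))
toℕ-unshuffle {n} i rewrite sym (toℕ-split i) with split i
... | inj₁ k = trans (toℕ-cast _ (k ↑ˡ ⌊ n /2⌋)) (toℕ-↑ˡ k _)
... | inj₂ k = trans (toℕ-cast _ (⌈ n /2⌉ ↑ʳ k)) (toℕ-↑ʳ _ k)

-- Labelings of copies

module _ {X : Set} {N m : ℕ} (A : X ↔ Fin N) (τ : X → Permutation′ m) where

  -- The block index comes first in the product, whence size `N * m` before the cast. Since `τ`
  -- depends on x alone, decoding x first tells which permutation of the copies to undo.
  blowUp : (Fin m × X) ↔ Fin (m * N)
  blowUp = cast-id (*-comm N m) ↔-∘ (↔-sym *↔× ↔-∘ mk↔ₛ′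
    (λ (j , x) → to A x , to (τ x) j)
    (λ (i , k) → from (τ (from A i)) k , from A i)
    (λ (i , k) → cong₂ _,_ (strictlyInverseˡ A i) (strictlyInverseˡ (τ (from A i)) k))
    (λ (j , x) → untwist (strictlyInverseʳ A x) j))
    where
    -- `from A (to A x)` is x only propositionally; a second variable lets the equation be matched
    -- with `refl`.
    untwist : ∀ {x y} → x ≡ y → ∀ j → (from (τ x) (to (τ y) j) , x) ≡ (j , y)
    untwist {x} refl j = cong (_, x) (strictlyInverseʳ (τ x) j)

  toℕ-blowUp : ∀ j x → toℕ (to blowUp (j , x)) ≡ m * toℕ (to A x) + toℕ (to (τ x) j)
  toℕ-blowUp j x = trans (toℕ-cast _ _) (toℕ-combine (to A x) (to (τ x) j))

module VerticesFirst (G : Graph) (V : Vertex G ↔ Fin (order G)) (E : Edge G ↔ Fin (size G)) where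

  labeling : Labeling G
  labeling = ↔⇒⤖ (↔-sym +↔⊎ ↔-∘ (V ⊎-↔ E))

  label-vertex : ∀ x → label {G} labeling (inj₁ x) ≡ suc (toℕ (to V x))
  label-vertex x = cong suc (toℕ-↑ˡ (to V x) (size G))

  label-edge : ∀ e → label {G} labeling (inj₂ e) ≡ suc (order G + toℕ (to E e))
  label-edge e = cong suc (toℕ-↑ʳ (order G) (to E e))

  vertex-labels : ∀ k → (∃[ x ] label {G} labeling (inj₁ x) ≡ k) ⇔ (1 ≤ k × k ≤ order G)
  vertex-labels k = mk⇔
    (λ { (x , refl) → s≤s z≤n , subst (_≤ order G) (sym (label-vertex x)) (toℕ<n (to V x)) })
    -- Matching on `1 ≤ k` exposes k as a successor, which cancels the shift of the labels and makes
    -- `k≤` the bound for `fromℕ<`.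
    (λ { (s≤s _ , k≤) → from V (fromℕ< k≤) , trans (label-vertex _)
          (cong suc (trans (cong toℕ (strictlyInverseˡ V (fromℕ< k≤))) (toℕ-fromℕ< k≤))) })

module _ {n : ℕ} where

  onVertices : Permutation′ n → Permutation′ n → LadderVertex n ↔ LadderVertex n
  onVertices σ τ = mk↔ₛ′
    (λ { (u i) → u (to σ i) ; (v i) → v (to τ i) })
    (λ { (u i) → u (from σ i) ; (v i) → v (from τ i) })
    (λ { (u i) → cong u (strictlyInverseˡ σ i) ; (v i) → cong v (strictlyInverseˡ τ i) })
    (λ { (u i) → cong u (strictlyInverseʳ σ i) ; (v i) → cong v (strictlyInverseʳ τ i) })

  onEdges : Permutation′ n → Permutation′ (n ∸ 1) → Permutation′ (n ∸ 1) →
            LadderEdge n ↔ LadderEdge n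
  onEdges ρ σ τ = mk↔ₛ′
    (λ { (rung i)   → rung (to ρ i)
       ; (u-rail i) → u-rail (to σ i)
       ; (v-rail i) → v-rail (to τ i) })
    (λ { (rung i)   → rung (from ρ i)
       ; (u-rail i) → u-rail (from σ i)
       ; (v-rail i) → v-rail (from τ i) })
    (λ { (rung i)   → cong rung (strictlyInverseˡ ρ i)
       ; (u-rail i) → cong u-rail (strictlyInverseˡ σ i)
       ; (v-rail i) → cong v-rail (strictlyInverseˡ τ i) })
    (λ { (rung i)   → cong rung (strictlyInverseʳ ρ i)
       ; (u-rail i) → cong u-rail (strictlyInverseʳ σ i)
       ; (v-rail i) → cong v-rail (strictlyInverseʳ τ i) })

module _ {m : ℕ} where

  twist : ℕ ⊎ ℕ → Permutation′ m
  twist = [ (λ _ → ↔-id _) , (λ _ → reverse) ]′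

  vertexTwist : ∀ {n} → LadderVertex n → Permutation′ m
  vertexTwist (u _) = ↔-id _
  vertexTwist (v _) = reverse

  edgeTwist : ∀ {n} → LadderEdge n → Permutation′ m
  edgeTwist (rung i)   = twist (half (toℕ i))
  edgeTwist (u-rail _) = ↔-id _
  edgeTwist (v-rail _) = reverse

-- The supermagic labeling of the ladders

module Ladders (m K : ℕ) where
  n h : ℕ
  n = suc (suc K)
  h = ⌈ n /2⌉

  G : Graph
  G = copies m (ladder n)

  π : ℕ ⊎ ℕ → ℕ
  π = [ id , h +_ ]′

  pointLabel : Point m → ℕ
  pointLabel (j , top , a)    = suc (m * (n ∸ suc a) + toℕ j)
  pointLabel (j , bottom , a) = suc (m * (n + π (half a)) + toℕ (opposite j))

  linkLabel : Fin m × Link → ℕ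
  linkLabel (j , rungᴸ a)        =
    suc (m * (n + n) + (m * π (half a) + toℕ (to (twist (half a)) j)))
  linkLabel (j , railᴸ top a)    =
    suc (m * (n + n) + (m * (n + a) + toℕ j))
  linkLabel (j , railᴸ bottom a) =
    suc (m * (n + n) + (m * (n + (suc K + (suc K ∸ suc a))) + toℕ (opposite j)))

  -- Eight shifts by 1 and four pairs of offsets j and m-1-j give 8 + 4(m-1) = 4 + 4m. In the
  -- bracket, 12n collects 2n from each of the four edges and n from each v vertex and each rail
  -- edge; the rest of the columns gives 2h + 2K + 1, that of the rails 2K + 1.
  magicSum : ℕ
  magicSum = 4 + 4 * m + m * (12 * n + 2 * h + 2 + 4 * K)

  -- With K = a + y all truncated subtractions disappear, and the claim is a
  -- semiring identity for each parity of a.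
  magic : Magic {n = n} pointLabel linkLabel magicSum
  magic j {a} (s≤s (s≤s a≤K)) with y , refl ← m≤n⇒∃[o]m+o≡n a≤K
    rewrite +-∸-assoc 1 (m≤m+n a y) | m+n∸m≡n a y = trans (go a (half a) (unhalf-half a))
      (cong (λ k → 4 + 4 * k + m * (12 * n + 2 * h + 2 + 4 * (a + y))) j₀+j₁)
    where
    j₀ j₁ : ℕ
    j₀ = toℕ j
    j₁ = toℕ (opposite j)

    j₀+j₁ : suc (j₀ + j₁) ≡ m
    j₀+j₁ = trans (cong (suc j₀ +_) (opposite-prop j)) (m+[n∸m]≡n (toℕ<n j))

    -- Only the term 4m needs i + j = m - 1, so `suc (i + j)` stands there and m stays a free
    -- variable elsewhere.
    even : ∀ m n h k y i j → let a = k + k in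
      suc (m * suc y + i) + suc (m * (n + k) + j) +
        suc (m * (n + n) + (m * k + i)) +
      (suc (m * y + i) + suc (m * (n + (h + k)) + j) +
        suc (m * (n + n) + (m * (h + k) + j))) +
      (suc (m * (n + n) + (m * (n + a) + i)) +
        suc (m * (n + n) + (m * (n + (suc (a + y) + y)) + j)))
      ≡ 4 + 4 * suc (i + j) + m * (12 * n + 2 * h + 2 + 4 * (a + y))
    even = solve-∀

    odd : ∀ m n h k y i j → let a = suc (k + k) in
      suc (m * suc y + i) + suc (m * (n + (h + k)) + j) +
        suc (m * (n + n) + (m * (h + k) + j)) +
      (suc (m * y + i) + suc (m * (n + suc k) + j) +
        suc (m * (n + n) + (m * suc k + i))) +
      (suc (m * (n + n) + (m * (n + a) + i)) +
        suc (m * (n + n) + (m * (n + (suc (a + y) + y)) + j)))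
      ≡ 4 + 4 * suc (i + j) + m * (12 * n + 2 * h + 2 + 4 * (a + y))
    odd = solve-∀

    -- `half (suc a)` unfolds to q once `half a` is abstracted to p, so one case split settles the
    -- parity of both columns.
    go : ∀ a p → a ≡ unhalf p → let q = [ inj₂ , inj₁ ∘ suc ]′ p in
      suc (m * suc y + j₀) + suc (m * (n + π p) + j₁) +
        suc (m * (n + n) + (m * π p + toℕ (to (twist p) j))) +
      (suc (m * y + j₀) + suc (m * (n + π q) + j₁) +
        suc (m * (n + n) + (m * π q + toℕ (to (twist q) j)))) +
      (suc (m * (n + n) + (m * (n + a) + j₀)) +
        suc (m * (n + n) + (m * (n + (suc (a + y) + y)) + j₁)))
      ≡ 4 + 4 * suc (j₀ + j₁) + m * (12 * n + 2 * h + 2 + 4 * (a + y))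
    go _ (inj₁ k) refl = even m n h k y j₀ j₁
    go _ (inj₂ k) refl = odd m n h k y j₀ j₁

  vertexOrder : LadderVertex n ↔ Fin (n + n)
  vertexOrder = vertices (ladder n) ↔-∘ onVertices reverse (unshuffle n)

  edgeOrder : LadderEdge n ↔ Fin (size (ladder n))
  edgeOrder = edges (ladder n) ↔-∘ onEdges (unshuffle n) (↔-id _) reverse

  open VerticesFirst G (blowUp vertexOrder vertexTwist) (blowUp edgeOrder edgeTwist)

  label-point : label {G} labeling ∘ inj₁ ≗ pointLabel ∘ point
  label-point (j , x) = trans (label-vertex (j , x))
    (trans (cong suc (toℕ-blowUp vertexOrder vertexTwist j x)) (at x))
    where
    at : ∀ x → suc (m * toℕ (to vertexOrder x) + toℕ (to (vertexTwist x) j)) ≡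
               pointLabel (point (j , x))
    at (u i) = cong (λ k → suc (m * k + toℕ j))
      (trans (toℕ-↑ˡ (opposite i) n) (opposite-prop i))
    at (v i) = cong (λ k → suc (m * k + toℕ (opposite j)))
      (trans (toℕ-↑ʳ n (to (unshuffle n) i)) (cong (n +_) (toℕ-unshuffle i)))

  label-link : label {G} labeling ∘ inj₂ ≗ linkLabel ∘ link
  label-link (j , e) = trans (label-edge (j , e))
    (trans (cong (λ k → suc (m * (n + n) + k)) (toℕ-blowUp edgeOrder edgeTwist j e)) (at e))
    where
    at : ∀ e → suc (m * (n + n) + (m * toℕ (to edgeOrder e) + toℕ (to (edgeTwist e) j))) ≡
               linkLabel (link (j , e))
    at (rung i)   =
      cong (λ k → suc (m * (n + n) + (m * k + toℕ (to (twist (half (toℕ i))) j))))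
        (trans (toℕ-↑ˡ (to (unshuffle n) i) _) (toℕ-unshuffle i))
    at (u-rail i) = cong (λ k → suc (m * (n + n) + (m * k + toℕ j)))
      (trans (toℕ-↑ʳ n (i ↑ˡ suc K)) (cong (n +_) (toℕ-↑ˡ i (suc K))))
    at (v-rail i) = cong (λ k → suc (m * (n + n) + (m * k + toℕ (opposite j))))
      (trans (toℕ-↑ʳ n (suc K ↑ʳ opposite i)) (cong (n +_)
        (trans (toℕ-↑ʳ (suc K) (opposite i)) (cong (suc K +_) (opposite-prop i)))))

  isMagic : IsMagic {G} labeling (cycle 4)
  isMagic = magicSum , λ S iso → let open Enumeration S iso in
    trans (weight-≡ labeling (pointLabel ∘ point) (linkLabel ∘ link) label-point label-link)
      (four-cycle pointLabel linkLabel magic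
        (joins⇒step _ (edgeOf-joins {0F} (inj₁ (refl , refl))))
        (joins⇒step _ (edgeOf-joins {1F} (inj₁ (refl , refl))))
        -- Edges 3 and 2 of the cycle are traversed backwards, which gives a second walk from vertex
        -- 0 to vertex 2, through vertex 3.
        (joins⇒step _ (edgeOf-joins {3F} (inj₂ (refl , refl))))
        (joins⇒step _ (edgeOf-joins {2F} (inj₂ (refl , refl))))
        (0≢2 ∘ vertexOf-injective ∘ point-injective)
        (1≢3 ∘ vertexOf-injective ∘ point-injective))
    where
    0≢2 : _≢_ {A = Fin 4} 0F 2F
    0≢2 ()

    1≢3 : _≢_ {A = Fin 4} 1F 3F
    1≢3 ()

  -- Vertices and edges are listed in cyclic order, so that the identity on
  -- Fin 4 is an isomorphism with the cycle.
  square : Fin m → Fin (suc K) → Subgraph G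
  square j i = record
    { vs = (j , u (inject₁ i)) ∷ (j , u (suc i)) ∷ (j , v (suc i)) ∷ (j , v (inject₁ i)) ∷ []
    ; es = (j , u-rail i) ∷ (j , rung (suc i)) ∷ (j , v-rail i) ∷ (j , rung (inject₁ i)) ∷ []
    -- Looplessness of a rail edge separates its two ends; equal rungs would have equal u-ends,
    -- against the same fact.
    ; vs-unique = (loopless G (j , u-rail i) ∷ (λ ()) ∷ (λ ()) ∷ [])
                ∷ ((λ ()) ∷ (λ ()) ∷ [])
                ∷ (loopless G (j , v-rail i) ∘ sym ∷ [])
                ∷ [] ∷ []
    ; es-unique = ((λ ()) ∷ (λ ()) ∷ (λ ()) ∷ [])
                ∷ ((λ ()) ∷ loopless G (j , u-rail i) ∘ cong (src G) ∘ sym ∷ [])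
                ∷ ((λ ()) ∷ [])
                ∷ [] ∷ []
    ; closed = (here refl , there (here refl))
             ∷ (there (here refl) , there (there (here refl)))
             ∷ (there (there (there (here refl))) , there (there (here refl)))
             ∷ (here refl , there (there (there (here refl))))
             ∷ []
    }

  square≅cycle : ∀ j i → toGraph (square j i) ≅ cycle 4
  square≅cycle j i = record
    { vertex-bijection = ↔-id _
    ; adjacency = λ _ _ → mk⇔ (map₂ λ {e} → ⇒cycle e) (map₂ λ {e} → cycle⇒ e)
    }
    where
    ⇒cycle : ∀ e {x y} → Joins (toGraph (square j i)) e x y → Joins (cycle 4) e x y
    ⇒cycle 0F = id
    ⇒cycle 1F = id
    -- The v-rail and the left rung are oriented against the cyclic order.
    ⇒cycle 2F = Sum.swap ∘ Sum.map swap swap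
    ⇒cycle 3F = Sum.swap ∘ Sum.map swap swap

    cycle⇒ : ∀ e {x y} → Joins (cycle 4) e x y → Joins (toGraph (square j i)) e x y
    cycle⇒ 0F = id
    cycle⇒ 1F = id
    cycle⇒ 2F = Sum.swap ∘ Sum.map swap swap
    cycle⇒ 3F = Sum.swap ∘ Sum.map swap swap

  covering : G HasCovering cycle 4
  covering (j , u-rail i)     = square j i , square≅cycle j i , here refl
  covering (j , v-rail i)     = square j i , square≅cycle j i , there (there (here refl))
  -- The first rung has a square only on its right, present since n is at least 2; every later rung
  -- takes the square on its left.
  covering (j , rung zero)    = square j zero , square≅cycle j zero ,
                                there (there (there (here refl)))
  covering (j , rung (suc i)) = square j i , square≅cycle j i , there (here refl)

  supermagic : Supermagic (cycle 4) G
  supermagic = covering , labeling , isMagic , vertex-labels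

theorem3 : (m n : ℕ) → 2 ≤ m → 2 ≤ n → Supermagic (cycle 4) (copies m (ladder n))
theorem3 m (suc (suc K)) _ (s≤s (s≤s _)) = Ladders.supermagic m K
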